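{- $D_{n,k}$ is the set of labeled Dyck paths of length $2n$ which end in a string of exactly $n-k$ "up-right" pairs.
   Context: A parking function of length $n$ is an $n$-tuple $(a_1,\dots,a_n)$ of positive integers which can be rearranged into weakly increasing order so that its $i$th entry is at most $i$ for every $i\in\{1,\dots,n\}$; $\mathrm{PF}_n$ is the set of these. For $1<k\le n$, $\mathrm{PF}_{n,k}$ is the set of $a\in\mathrm{PF}_n$ for which $k$ is the largest missing number, i.e. $k$ is not an entry of $a$ but each of $k+1,\dots,n$ is an entry of $a$. The remaining parking functions are those that are permutations of $(1,\dots,n)$, and they are identified with the elements of the symmetric group $\mathrm{Sym}_n$; thus $\mathrm{PF}_n=\mathrm{Sym}_n\sqcup\mathrm{PF}_{n,2}\sqcup\dots\sqcup\mathrm{PF}_{n,n}$. A Dyck path of length $2n$ is a lattice path in $\mathbb{Z}\oplus\mathbb{Z}$ from $(0,0)$ to $(n,n)$ which stays weakly above the diagonal $y=x$ and consists only of "up" steps $(0,1)$ and "right" steps $(1,0)$. A labeled Dyck path is a Dyck path for which the $n$ up steps are distinctly labeled by $\{1,\dots,n\}$. To each $(a_1,\dots,a_n)\in\mathrm{PF}_n$ one associates a labeled Dyck path of length $2n$ as follows: let $b_i$ be the number of times $i$ appears in the parking function, and draw the path from $(0,0)$ to $(n,n)$ with $b_1$ up steps followed by one right step, then $b_2$ up steps followed by one right step, and so on (the $b_i$ up steps preceding the $i$th right step are those in column $i$); then label the bottom-most unlabeled up step in column $a_1$ with $1$, the bottom-most unlabeled up step in column $a_2$ with $2$, and so on. This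 is the correspondence used between $\mathrm{PF}_n$ and labeled Dyck paths of length $2n$. $D_{n,k}$ is the set of labeled Dyck paths which correspond in this way to the parking functions in $\mathrm{PF}_{n,k}$, and $D_{n,1}$ is the set of those which correspond to the parking functions identified with $\mathrm{Sym}_n$.
   Formalization: Labels of a labeled Dyck path are required to increase up each column (otherwise UURR labeled 2,1 is a counterexample), and for k = 1 "exactly n−1 up-right pairs" is replaced by "ends in n−1 up-right pairs", since such paths in fact end in n pairs. -}

module Defs where

open import Data.Nat using (ℕ; zero; suc; _≤_; _<_; _≟_)
open import Data.Nat.Properties using (≤-totalOrder)
open import Data.Fin as Fin using (Fin; toℕ)
open import Data.List using (List; []; _∷_; _++_; map; concat; concatMap; replicate; applyUpTo; allFin; mapMaybe; foldl; lookup)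
open import Data.List.Scans.Base using (scanl)
open import Data.List.Relation.Unary.All using (All)
open import Data.List.Relation.Unary.Linked using (Linked)
open import Data.List.Relation.Unary.Sorted.TotalOrder ≤-totalOrder using (Sorted)
open import Data.List.Relation.Unary.Unique.Propositional using (Unique)
open import Data.List.Relation.Binary.Permutation.Propositional using (_↭_)
open import Data.Maybe using (Maybe; just; nothing)
open import Data.Product using (_×_; _,_; ∃-syntax)
open import Data.Unit using (⊤; tt)
open import Data.Vec as Vec using (Vec; toList; count)
open import Data.Vec.Membership.Propositional using (_∈_; _∉_)
open import Data.Vec.Relation.Unary.All as VecAll using ()
open import Relation.Binary.PropositionalEquality using (_≡_)
open import Relation.Nullary using (¬_)

-- Positions in `Fin n` count from 0, so the position i stands for i + 1.
IsParkingFunction : ∀ {n} → Vec ℕ n → Set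
IsParkingFunction a =
  VecAll.All (1 ≤_) a ×
  ∃[ c ] (c ↭ toList a × Sorted c × (∀ i → lookup c i ≤ suc (toℕ i)))

-- The set PF_{n,k}, for 1 < k ≤ n.
LargestMissing : (n k : ℕ) → Vec ℕ n → Set
LargestMissing n k a =
  IsParkingFunction a × k ∉ a × (∀ m → k < m → m ≤ n → m ∈ a)

-- The parking functions identified with Sym_n.
IsPermutation : (n : ℕ) → Vec ℕ n → Set
IsPermutation n a = IsParkingFunction a × toList a ↭ applyUpTo suc n

data Step (A : Set) : Set where
  up    : A → Step A
  right : Step A

mapStep : {A B : Set} → (A → B) → Step A → Step B
mapStep f (up x) = up (f x)
mapStep f right  = right

Path : Set
Path = List (Step ⊤)

-- The label i : Fin n stands for the number i + 1 in {1, …, n}.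
LabeledPath : ℕ → Set
LabeledPath n = List (Step (Fin n))

underlying : {A : Set} → List (Step A) → Path
underlying = map (mapStep (λ _ → tt))

-- Paths start at (0 , 0) and no step decreases a coordinate, so natural
-- number coordinates suffice.
Point : Set
Point = ℕ × ℕ

move : {A : Set} → Point → Step A → Point
move (x , y) (up _) = x , suc y
move (x , y) right  = suc x , y

WeaklyAboveDiagonal : Point → Set
WeaklyAboveDiagonal (x , y) = x ≤ y

IsDyckPath : ℕ → Path → Set
IsDyckPath n p =
  foldl move (0 , 0) p ≡ (n , n) ×
  All WeaklyAboveDiagonal (scanl move (0 , 0) p)

label : {A : Set} → Step A → Maybe A
label (up x) = just x
label right  = nothing

labels : ∀ {n} → LabeledPath n → List (Fin n)
labels = mapMaybe label

-- A constraint only when both steps are up steps.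
_<ᵘ_ : ∀ {n} → Step (Fin n) → Step (Fin n) → Set
up i <ᵘ up j = i Fin.< j
_    <ᵘ _    = ⊤

-- Besides being distinct, labels are required to increase up each column
-- (a maximal run of consecutive up steps).  This is the standard
-- convention, and the one under which labeled Dyck paths correspond to
-- parking functions: labels are placed in increasing order, each as low
-- as possible in its column.
record IsLabeledDyckPath (n : ℕ) (p : LabeledPath n) : Set where
  field
    isDyckPath         : IsDyckPath n (underlying p)
    labelsDistinct     : Unique (labels p)
    columnsIncreasing  : Linked _<ᵘ_ p

-- `nothing` marks an up step which has not been labeled yet.
PartialPath : ℕ → Set
PartialPath n = List (Step (Maybe (Fin n)))

draw : ∀ {n} → Vec ℕ n → PartialPath n
draw {n} a =
  concatMap (λ i → replicate (count (i ≟_) a) (up nothing) ++ right ∷ [])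
            (applyUpTo suc n)

-- `labelBottom c j p` puts j on the first unlabeled up step of p having
-- exactly c - 1 right steps before it (columns are numbered from 1), and
-- leaves p unchanged if there is no such step.
labelBottom : ∀ {n} → ℕ → Fin n → PartialPath n → PartialPath n
labelBottom c             j []                  = []
labelBottom zero          j p                   = p
labelBottom 1             j (up nothing  ∷ p)   = up (just j) ∷ p
labelBottom 1             j (up (just i) ∷ p)   = up (just i) ∷ labelBottom 1 j p
labelBottom 1             j (right       ∷ p)   = right ∷ p
labelBottom (suc (suc c)) j (up x        ∷ p)   = up x ∷ labelBottom (suc (suc c)) j p
labelBottom (suc (suc c)) j (right       ∷ p)   = right ∷ labelBottom (suc c) j p

drawLabeled : ∀ {n} → Vec ℕ n → PartialPath n
drawLabeled {n} a =
  foldl (λ p j → labelBottom (Vec.lookup a j) j p) (draw a) (allFin n)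

-- The procedure ends with every up step labeled, and p is the result.
CorrespondsTo : ∀ {n} → Vec ℕ n → LabeledPath n → Set
CorrespondsTo a p = drawLabeled a ≡ map (mapStep just) p

D : (n k : ℕ) → LabeledPath n → Set
D n 1 p = ∃[ a ] (IsPermutation n a × CorrespondsTo a p)
D n k p = ∃[ a ] (LargestMissing n k a × CorrespondsTo a p)

upRightPairs : ℕ → Path
upRightPairs m = concat (replicate m (up tt ∷ right ∷ []))

EndsInPairs : ∀ {n} → ℕ → LabeledPath n → Set
EndsInPairs m p = ∃[ q ] (underlying p ≡ q ++ upRightPairs m)

EndsInExactlyPairs : ∀ {n} → ℕ → LabeledPath n → Set
EndsInExactlyPairs m p = EndsInPairs m p × ¬ EndsInPairs (suc m) p

{-# OPTIONS --safe #-}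
module Submission where

-- Both sides are read column by column: a parking function a gives column i the
-- labels j with a_j = i, and a path which is a concatenation of columns is Dyck
-- exactly when, for every m, its first m columns hold at least m labels.  Given
-- this, the last m columns hold at most m labels altogether, so the path ends in m
-- up-right pairs iff none of these columns is empty, i.e. iff all the numbers
-- n - m + 1, …, n are entries of a.  For m = n - k, failure for m + 1 then says
-- that k is missing.

open import Defs
open import Data.Fin as Fin using (Fin; toℕ)
open import Data.Fin.Properties using (toℕ<n)
  renaming (_≟_ to _≟ᶠ_; <-trans to <ᶠ-trans; <-asym to <ᶠ-asym; <-irrefl to <ᶠ-irrefl)
open import Data.List
open import Data.List.Membership.DecPropositional using () renaming (_∈?_ to member?)
open import Data.List.Membership.Propositional using (_∈_)
open import Data.List.Membership.Propositional.Properties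
  using (∈-filter⁺; ∈-filter⁻; ∈-allFin; ∈-lookup; ∈-∃++; ∈-length; ∈-++⁺ʳ;
          ∈-applyUpTo⁺; ∈-applyUpTo⁻; ∈-concat⁺′)
open import Data.List.Properties
open import Data.List.Relation.Binary.Disjoint.Propositional using (Disjoint)
open import Data.List.Relation.Binary.Permutation.Propositional
  using (_↭_; prep; ↭-sym; ↭-trans; ↭-reflexive)
open import Data.List.Relation.Binary.Permutation.Propositional.Properties
  using (↭-length; filter-↭; shift; ∈-resp-↭)
open import Data.List.Relation.Unary.All as All using (All; []; _∷_)
import Data.List.Relation.Unary.All.Properties as All
open import Data.List.Relation.Unary.AllPairs using (AllPairs; []; _∷_)
import Data.List.Relation.Unary.AllPairs.Properties as AllPairs
open import Data.List.Relation.Unary.Any using (here; there)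
open import Data.List.Relation.Unary.Linked as Linked using (Linked; []; [-]; _∷_)
open import Data.List.Relation.Unary.Linked.Properties using (Linked⇒AllPairs; AllPairs⇒Linked)
open import Data.List.Relation.Unary.Sorted.TotalOrder.Properties using (Sorted⇒AllPairs)
open import Data.List.Relation.Unary.Unique.Propositional using (Unique)
import Data.List.Relation.Unary.Unique.Propositional.Properties as Unique
open import Data.List.Scans.Base using (scanl)
open import Data.Maybe using (Maybe; just; nothing)
open import Data.Nat
  using (ℕ; zero; suc; _+_; _∸_; _≤_; _<_; _≟_; _≤?_; z≤n; s≤s; s≤s⁻¹)
open import Data.Nat.Properties
import Data.List.Sort ≤-decTotalOrder as Sort
open import Data.Product using (_×_; _,_; proj₁; proj₂; ∃-syntax)
open import Data.Product.Properties using (,-injective)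
open import Data.Sum using (_⊎_; [_,_]′; map₁; map₂)
open import Data.Unit using (⊤; tt)
open import Data.Vec as Vec using (Vec; toList; count)
open import Data.Vec.Membership.Propositional using () renaming (_∈_ to _∈ᵛ_)
open import Data.Vec.Membership.Propositional.Properties
  using (∈-toList⁺; ∈-toList⁻) renaming (∈-lookup to ∈ᵛ-lookup)
import Data.Vec.Properties as Vec
import Data.Vec.Relation.Unary.All as VecAll
import Data.Vec.Relation.Unary.All.Properties as VecAll
import Data.Vec.Relation.Unary.Any as VecAny
import Data.Vec.Relation.Unary.Any.Properties as VecAny
open import Function using (_∘_; id)
open import Function.Bundles using (_⇔_; mk⇔; Equivalence)
open import Relation.Binary.PropositionalEquality
open import Relation.Nullary using (¬_; yes; no; contradiction)
open import Relation.Unary using (Decidable)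

-- The drawing procedure treats one label at a time, so its result comes from an invariant: at every
-- stage each column consists of the labels already placed in it, in increasing order, below steps
-- still unlabeled. At the end each column lists its labels increasingly. This also makes the
-- correspondence invertible: a column with increasing labels is determined by its set of labels,
-- and since labels are distinct, `a_j` can be read off as the number of the column containing `j`.
--
-- The ballot condition on columns is where the two sides meet: for a parking function it says that
-- at least `m` entries are at most `m`, for a path that its height after the `m`th right step is at
-- least `m`.
--
-- The case `k = 1` is stated without "exactly" for a reason: if the last `n - 1` columns hold one
-- label each, the one remaining label fills the first column, so the path ends in `n` pairs and
-- never in exactly `n - 1`. Correspondingly 1 is an entry of every nonempty parking function.

private variable
  A B : Set

applyUpTo-cong : {f g : ℕ → A} → (∀ i → f i ≡ g i) → ∀ n → applyUpTo f n ≡ applyUpTo g n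
applyUpTo-cong eq zero    = refl
applyUpTo-cong eq (suc n) = cong₂ _∷_ (eq 0) (applyUpTo-cong (eq ∘ suc) n)

-- Paths as concatenations of columns

-- Polymorphic, since labeled, partially labeled and unlabeled paths are all decomposed in this way.
fill : List (List A) → List (Step A)
fill []       = []
fill (c ∷ cs) = map up c ++ right ∷ fill cs

fill-++ : (cs ds : List (List A)) → fill (cs ++ ds) ≡ fill cs ++ fill ds
fill-++ []       ds = refl
fill-++ (c ∷ cs) ds =
  trans (cong (λ p → map up c ++ right ∷ p) (fill-++ cs ds))
        (sym (++-assoc (map up c) (right ∷ fill cs) (fill ds)))

map-mapStep-up : (f : A → B) (c : List A) → map (mapStep f) (map up c) ≡ map up (map f c)
map-mapStep-up f c = trans (sym (map-∘ c)) (map-∘ c)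

map-fill : (f : A → B) (cs : List (List A)) → map (mapStep f) (fill cs) ≡ fill (map (map f) cs)
map-fill f []       = refl
map-fill f (c ∷ cs) = trans (map-++ (mapStep f) (map up c) (right ∷ fill cs))
  (cong₂ (λ p q → p ++ right ∷ q) (map-mapStep-up f c) (map-fill f cs))

labels-fill : ∀ {n} (cs : List (List (Fin n))) → labels (fill cs) ≡ concat cs
labels-fill []             = refl
labels-fill ([] ∷ cs)      = labels-fill cs
labels-fill ((x ∷ c) ∷ cs) = cong (x ∷_) (labels-fill (c ∷ cs))

-- The first `right` shows where the first column ends.
∷-fill-injective : (c d : List A) {p q : List (Step A)} →
  map up c ++ right ∷ p ≡ map up d ++ right ∷ q → c ≡ d × p ≡ q
∷-fill-injective []      []      refl = refl , refl
∷-fill-injective (x ∷ c) (y ∷ d) eq with ∷-injective eq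
... | refl , eq′ with ∷-fill-injective c d eq′
... | refl , p≡q = refl , p≡q

fill-injective : (cs ds : List (List A)) → fill cs ≡ fill ds → cs ≡ ds
fill-injective []       []       eq = refl
fill-injective []       ([] ∷ ds) ()
fill-injective []       ((x ∷ d) ∷ ds) ()
fill-injective ([] ∷ cs) []      ()
fill-injective ((x ∷ c) ∷ cs) [] ()
fill-injective (c ∷ cs) (d ∷ ds) eq with ∷-fill-injective c d eq
... | refl , eq′ = cong (c ∷_) (fill-injective cs ds eq′)

-- An arbitrary path may have up steps `r` after its last right step; for a Dyck path they are
-- excluded later, by counting.
unfill : (p : List (Step A)) → ∃[ cs ] ∃[ r ] p ≡ fill cs ++ map up r
unfill [] = [] , [] , refl
unfill (right ∷ p) with unfill p
... | cs , r , refl = [] ∷ cs , r , refl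
unfill (up x ∷ p) with unfill p
... | []     , r , refl = [] , x ∷ r , refl
... | c ∷ cs , r , refl = (x ∷ c) ∷ cs , r , refl

-- The result of the labeling procedure

-- Columns are numbered from 0 here and from 1 in the values of f.
column : (A → ℕ) → List A → ℕ → List A
column f js i = filter (λ j → suc i ≟ f j) js

columns : ∀ {n} → Vec ℕ n → List (List (Fin n))
columns {n} a = applyUpTo (column (Vec.lookup a) (allFin n)) n

labelBottom-column : ∀ {n} (j : Fin n) xs ys p →
  labelBottom 1 j (map up (map just xs ++ nothing ∷ ys) ++ p)
    ≡ map up (map just xs ++ just j ∷ ys) ++ p
labelBottom-column j []       ys p = refl
labelBottom-column j (x ∷ xs) ys p = cong (up (just x) ∷_) (labelBottom-column j xs ys p)

labelBottom-right : ∀ {n} c (j : Fin n) d p →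
  labelBottom (suc (suc c)) j (map up d ++ right ∷ p) ≡ map up d ++ right ∷ labelBottom (suc c) j p
labelBottom-right c j []      p = refl
labelBottom-right c j (x ∷ d) p = cong (up x ∷_) (labelBottom-right c j d p)

labelBottom-zero : ∀ {n} (j : Fin n) p → labelBottom zero j p ≡ p
labelBottom-zero j []      = refl
labelBottom-zero j (x ∷ p) = refl

-- Columns are given by functions so that the change at `c` can be stated pointwise. If `c` lies
-- beyond the `m` columns, nothing changes and `h`, `h′` agree on all of them.
labelBottom-fill : ∀ {n} (j : Fin n) {h h′ : ℕ → List (Maybe (Fin n))} c xs ys →
  (∀ i → i ≢ c → h i ≡ h′ i) → h c ≡ map just xs ++ nothing ∷ ys → h′ c ≡ map just xs ++ just j ∷ ys →
  ∀ m → labelBottom (suc c) j (fill (applyUpTo h m)) ≡ fill (applyUpTo h′ m)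
labelBottom-fill j c xs ys rest old new zero = refl
labelBottom-fill j {h} {h′} zero xs ys rest old new (suc m) rewrite old | new =
  trans (labelBottom-column j xs ys _)
    (cong (λ cs → map up (map just xs ++ just j ∷ ys) ++ right ∷ fill cs)
      (applyUpTo-cong (λ i → rest (suc i) λ ()) m))
labelBottom-fill j {h} {h′} (suc c) xs ys rest old new (suc m) =
  trans (labelBottom-right c j (h 0) _)
    (cong₂ (λ d p → map up d ++ right ∷ p) (rest 0 λ ())
      (labelBottom-fill j c xs ys (λ i i≢c → rest (suc i) (i≢c ∘ suc-injective)) old new m))

module _ {n : ℕ} (f : Fin n → ℕ) where

  -- The (i + 1)st column once the labels js have been placed, while the labels ks are still to come.
  partialColumn : List (Fin n) → List (Fin n) → ℕ → List (Maybe (Fin n))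
  partialColumn js ks i = map just (column f js i) ++ replicate (length (column f ks i)) nothing

  partialColumn-other : ∀ js k ks i → suc i ≢ f k →
    partialColumn js (k ∷ ks) i ≡ partialColumn (js ++ k ∷ []) ks i
  partialColumn-other js k ks i i≢ = cong₂ (λ xs ys → map just xs ++ replicate (length ys) nothing)
    (sym (trans (filter-++ (λ j → suc i ≟ f j) js (k ∷ []))
      (trans (cong (column f js i ++_) (filter-reject (λ j → suc i ≟ f j) i≢)) (++-identityʳ _))))
    (filter-reject (λ j → suc i ≟ f j) i≢)

  partialColumn-old : ∀ js k ks i → suc i ≡ f k →
    partialColumn js (k ∷ ks) i
      ≡ map just (column f js i) ++ nothing ∷ replicate (length (column f ks i)) nothing
  partialColumn-old js k ks i i≡ =
    cong (λ ys → map just (column f js i) ++ replicate (length ys) nothing)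
      (filter-accept (λ j → suc i ≟ f j) i≡)

  partialColumn-new : ∀ js k ks i → suc i ≡ f k →
    partialColumn (js ++ k ∷ []) ks i
      ≡ map just (column f js i) ++ just k ∷ replicate (length (column f ks i)) nothing
  partialColumn-new js k ks i i≡ = trans
    (cong (λ xs → map just xs ++ replicate (length (column f ks i)) nothing)
      (trans (filter-++ (λ j → suc i ≟ f j) js (k ∷ []))
             (cong (column f js i ++_) (filter-accept (λ j → suc i ≟ f j) i≡))))
    (trans (cong (_++ replicate (length (column f ks i)) nothing) (map-++ just (column f js i) (k ∷ [])))
           (++-assoc (map just (column f js i)) _ _))

  -- One round of the loop: `k` passes from the labels to come to those placed. If its value is 0,
  -- it lies in no column and `labelBottom zero` leaves the path alone.
  labelBottom-partialColumns : ∀ js k ks m {c} → f k ≡ c →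
    labelBottom c k (fill (applyUpTo (partialColumn js (k ∷ ks)) m))
      ≡ fill (applyUpTo (partialColumn (js ++ k ∷ []) ks) m)
  labelBottom-partialColumns js k ks m {zero} eq = trans (labelBottom-zero k _)
    (cong fill (applyUpTo-cong (λ i → partialColumn-other js k ks i λ e → 0≢1+n (sym (trans e eq))) m))
  labelBottom-partialColumns js k ks m {suc c} eq = labelBottom-fill k c (column f js c) _
    (λ i i≢c → partialColumn-other js k ks i λ e → i≢c (suc-injective (trans e eq)))
    (partialColumn-old js k ks c (sym eq)) (partialColumn-new js k ks c (sym eq)) m

  foldl-labelBottom : ∀ js ks m →
    foldl (λ p j → labelBottom (f j) j p) (fill (applyUpTo (partialColumn js ks) m)) ks
      ≡ fill (applyUpTo (partialColumn (js ++ ks) []) m)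
  foldl-labelBottom js []       m =
    cong (λ xs → fill (applyUpTo (partialColumn xs []) m)) (sym (++-identityʳ js))
  foldl-labelBottom js (k ∷ ks) m = trans
    (cong (λ p → foldl (λ p j → labelBottom (f j) j p) p ks) (labelBottom-partialColumns js k ks m refl))
    (trans (foldl-labelBottom (js ++ k ∷ []) ks m)
      (cong (λ xs → fill (applyUpTo (partialColumn xs []) m)) (++-assoc js (k ∷ []) ks)))

filter-map : {P : B → Set} (P? : Decidable P) (f : A → B) (xs : List A) →
  filter P? (map f xs) ≡ map f (filter (P? ∘ f) xs)
filter-map P? f []       = refl
filter-map P? f (x ∷ xs) with P? (f x)
... | yes _ = cong (f x ∷_) (filter-map P? f xs)
... | no  _ = filter-map P? f xs

map-lookup-allFin : ∀ {n} (a : Vec A n) → map (Vec.lookup a) (allFin n) ≡ toList a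
map-lookup-allFin Vec.[]      = refl
map-lookup-allFin (x Vec.∷ a) = cong (x ∷_)
  (trans (cong (map (Vec.lookup (x Vec.∷ a))) (sym (map-tabulate id Fin.suc)))
    (trans (sym (map-∘ (allFin _))) (map-lookup-allFin a)))

-- Columns filter the positions of `a`, whereas the parking condition concerns its entries; mapping
-- positions to entries links the two counts.
length-filter-lookup : ∀ {n} {P : A → Set} (P? : Decidable P) (a : Vec A n) →
  length (filter (P? ∘ Vec.lookup a) (allFin n)) ≡ length (filter P? (toList a))
length-filter-lookup {n = n} P? a = trans (sym (length-map (Vec.lookup a) (filter (P? ∘ Vec.lookup a) (allFin n))))
  (cong length (trans (sym (filter-map P? (Vec.lookup a) (allFin n)))
    (cong (filter P?) (map-lookup-allFin a))))

count≡length-filter : ∀ {n} {P : A → Set} (P? : Decidable P) (a : Vec A n) →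
  count P? a ≡ length (filter P? (toList a))
count≡length-filter P? Vec.[]      = refl
count≡length-filter P? (x Vec.∷ a) with P? x
... | yes _ = cong suc (count≡length-filter P? a)
... | no  _ = count≡length-filter P? a

concatMap-column : (f : ℕ → List (Step A)) (h : ℕ → List A) → (∀ i → f (suc i) ≡ map up (h i)) →
  ∀ m → concatMap (λ i → f i ++ right ∷ []) (applyUpTo suc m) ≡ fill (applyUpTo h m)
concatMap-column {A} f h eq m = trans (cong concat (map-applyUpTo suc _ m)) (go f h eq m)
  where
  go : (f : ℕ → List (Step A)) (h : ℕ → List A) → (∀ i → f (suc i) ≡ map up (h i)) →
    ∀ m → concat (applyUpTo (λ i → f (suc i) ++ right ∷ []) m) ≡ fill (applyUpTo h m)
  go f h eq zero    = refl
  go f h eq (suc m) = trans (++-assoc (f 1) (right ∷ []) _)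
    (cong₂ (λ p q → p ++ right ∷ q) (eq 0) (go (f ∘ suc) (h ∘ suc) (eq ∘ suc) m))

draw≡fill : ∀ {n} (a : Vec ℕ n) →
  draw a ≡ fill (applyUpTo (partialColumn (Vec.lookup a) [] (allFin n)) n)
draw≡fill {n} a = concatMap-column (λ i → replicate (count (i ≟_) a) (up nothing)) _ eq n
  where
  eq : ∀ i → replicate (count (suc i ≟_) a) (up nothing)
           ≡ map up (partialColumn (Vec.lookup a) [] (allFin n) i)
  eq i = sym (trans (map-replicate up _ nothing) (cong (λ m → replicate m (up nothing))
    (trans (length-filter-lookup (suc i ≟_) a) (sym (count≡length-filter (suc i ≟_) a)))))

drawLabeled≡fill : ∀ {n} (a : Vec ℕ n) → drawLabeled a ≡ map (mapStep just) (fill (columns a))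
drawLabeled≡fill {n} a = begin
  drawLabeled a
    ≡⟨ cong (λ p → foldl (λ p j → labelBottom (Vec.lookup a j) j p) p (allFin n)) (draw≡fill a) ⟩
  foldl (λ p j → labelBottom (Vec.lookup a j) j p)
    (fill (applyUpTo (partialColumn (Vec.lookup a) [] (allFin n)) n)) (allFin n)
    ≡⟨ foldl-labelBottom (Vec.lookup a) [] (allFin n) n ⟩
  fill (applyUpTo (partialColumn (Vec.lookup a) (allFin n) []) n)
    ≡⟨ cong fill (applyUpTo-cong (λ i → ++-identityʳ _) n) ⟩
  fill (applyUpTo (map just ∘ column (Vec.lookup a) (allFin n)) n)
    ≡⟨ cong fill (map-applyUpTo _ (map just) n) ⟨
  fill (map (map just) (columns a))
    ≡⟨ map-fill just (columns a) ⟨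
  map (mapStep just) (fill (columns a)) ∎
  where open ≡-Reasoning

mapStep-just-injective : {s t : Step A} → mapStep just s ≡ mapStep just t → s ≡ t
mapStep-just-injective {s = up _} {up _} refl = refl
mapStep-just-injective {s = right} {right} refl = refl

-- `map (mapStep just)` is injective, so the finished drawing determines `p`. The procedure enters
-- the rest of the proof only through this closed form.
CorrespondsTo⇔fill : ∀ {n} (a : Vec ℕ n) p → CorrespondsTo a p ⇔ p ≡ fill (columns a)
CorrespondsTo⇔fill a p = mk⇔
  (λ eq → sym (map-injective mapStep-just-injective (trans (sym (drawLabeled≡fill a)) eq)))
  (λ { refl → drawLabeled≡fill a })

-- Parking functions and the ballot condition

filter-≤-lower : ∀ {M} (c : List ℕ) m → m ≤ length c →
  (∀ i → toℕ i < m → lookup c i ≤ M) → m ≤ length (filter (_≤? M) c)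
filter-≤-lower c       zero    m≤ bound = z≤n
filter-≤-lower {M} (x ∷ c) (suc m) (s≤s m≤) bound
  rewrite filter-accept (_≤? M) {xs = c} (bound Fin.zero (s≤s z≤n)) =
  s≤s (filter-≤-lower c m m≤ λ i i<m → bound (Fin.suc i) (s≤s i<m))

-- In a sorted list the entries at most `M` form an initial segment: once the head exceeds `M`, the
-- filter is empty.
lookup-≤-sorted : ∀ {M} {c : List ℕ} → AllPairs _≤_ c →
  ∀ i → toℕ i < length (filter (_≤? M) c) → lookup c i ≤ M
lookup-≤-sorted {M} {x ∷ c} (x≤c ∷ sorted) i i< with x ≤? M
lookup-≤-sorted {M} {x ∷ c} (x≤c ∷ sorted) Fin.zero    i< | yes x≤M = x≤M
lookup-≤-sorted {M} {x ∷ c} (x≤c ∷ sorted) (Fin.suc i) i< | yes x≤M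
  rewrite filter-accept (_≤? M) {xs = c} x≤M = lookup-≤-sorted sorted i (s≤s⁻¹ i<)
lookup-≤-sorted {M} {x ∷ c} (x≤c ∷ sorted) i i< | no x≰M
  rewrite filter-none (_≤? M) {x ∷ c} (x≰M ∷ All.map (λ x≤y y≤M → x≰M (≤-trans x≤y y≤M)) x≤c) =
  contradiction i< λ ()

-- Counts are invariant under permutation, so they pass between `a` and any rearrangement;
-- conversely the rearrangement is obtained by sorting, and its entry at `i` is bounded by the count
-- for `suc (toℕ i)`.
IsParkingFunction⇔count : ∀ {n} (a : Vec ℕ n) → IsParkingFunction a ⇔
  (VecAll.All (1 ≤_) a × (∀ m → m ≤ n → m ≤ length (filter (_≤? m) (toList a))))
IsParkingFunction⇔count {n} a = mk⇔ to from
  where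
  to : IsParkingFunction a → _
  to (positive , c , c↭a , _ , bound) = positive , λ m m≤n →
    subst (m ≤_) (↭-length (filter-↭ (_≤? m) c↭a))
      (filter-≤-lower c m (subst (m ≤_) (sym (trans (↭-length c↭a) (Vec.length-toList a))) m≤n)
        λ i i<m → ≤-trans (bound i) i<m)
  from : _ → IsParkingFunction a
  from (positive , enough) = positive , c , Sort.sort-↭ _ , Sort.sort-↗ _ , λ i →
    lookup-≤-sorted (Sorted⇒AllPairs ≤-totalOrder (Sort.sort-↗ (toList a))) i
      (subst (suc (toℕ i) ≤_) (sym (↭-length (filter-↭ (_≤? suc (toℕ i)) (Sort.sort-↭ (toList a)))))
        (enough _ (subst (suc (toℕ i) ≤_)
          (trans (↭-length (Sort.sort-↭ (toList a))) (Vec.length-toList a)) (toℕ<n i))))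
    where
    c = Sort.sort (toList a)

length-filter-⊎ : {P Q R : A → Set} (P? : Decidable P) (Q? : Decidable Q) (R? : Decidable R) →
  (∀ {x} → P x → ¬ Q x) → (∀ {x} → P x → R x) → (∀ {x} → Q x → R x) → (∀ {x} → R x → P x ⊎ Q x) →
  ∀ xs → length (filter P? xs) + length (filter Q? xs) ≡ length (filter R? xs)
length-filter-⊎ P? Q? R? P⇒¬Q P⇒R Q⇒R R⇒P⊎Q = go
  where
  go : ∀ xs → length (filter P? xs) + length (filter Q? xs) ≡ length (filter R? xs)
  go []       = refl
  go (x ∷ xs) with P? x | Q? x | R? x
  ... | yes p | yes q | _     = contradiction q (P⇒¬Q p)
  ... | yes p | no  q | yes r = cong suc (go xs)
  ... | yes p | no  q | no ¬r = contradiction (P⇒R p) ¬r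
  ... | no ¬p | yes q | yes r = trans (+-suc _ _) (cong suc (go xs))
  ... | no ¬p | yes q | no ¬r = contradiction (Q⇒R q) ¬r
  ... | no ¬p | no ¬q | yes r = contradiction (R⇒P⊎Q r) [ ¬p , ¬q ]′
  ... | no ¬p | no ¬q | no ¬r = go xs

length-filter-≤-suc : (f : A → ℕ) (js : List A) → ∀ m →
  length (filter (λ j → f j ≤? m) js) + length (column f js m) ≡ length (filter (λ j → f j ≤? suc m) js)
length-filter-≤-suc f js m =
  length-filter-⊎ (λ j → f j ≤? m) (λ j → suc m ≟ f j) (λ j → f j ≤? suc m)
    (λ p q → 1+n≰n (subst (_≤ m) (sym q) p)) m≤n⇒m≤1+n (≤-reflexive ∘ sym)
    (λ r → map₁ s≤s⁻¹ (map₂ sym (m≤n⇒m<n∨m≡n r))) js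

-- Positivity matters at `m = 0`: a value 0 would be counted on the right but lies in no column.
length-concat-columns : (f : A → ℕ) (js : List A) → (∀ j → 1 ≤ f j) → ∀ m →
  length (concat (applyUpTo (column f js) m)) ≡ length (filter (λ j → f j ≤? m) js)
length-concat-columns f js 1≤f zero =
  sym (cong length (filter-none (λ j → f j ≤? 0)
    (All.universal (λ j fj≤0 → contradiction (≤-trans (1≤f j) fj≤0) λ ()) js)))
length-concat-columns f js 1≤f (suc m) = begin
  length (concat (applyUpTo (column f js) (suc m)))
    ≡⟨ cong (length ∘ concat) (applyUpTo-∷ʳ (column f js) m) ⟨
  length (concat (applyUpTo (column f js) m ++ column f js m ∷ []))
    ≡⟨ cong length (concat-++ (applyUpTo (column f js) m) _) ⟨
  length (concat (applyUpTo (column f js) m) ++ column f js m ++ [])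
    ≡⟨ length-++ (concat (applyUpTo (column f js) m)) ⟩
  length (concat (applyUpTo (column f js) m)) + length (column f js m ++ [])
    ≡⟨ cong₂ _+_ (length-concat-columns f js 1≤f m) (cong length (++-identityʳ (column f js m))) ⟩
  length (filter (λ j → f j ≤? m) js) + length (column f js m)
    ≡⟨ length-filter-≤-suc f js m ⟩
  length (filter (λ j → f j ≤? suc m) js) ∎
  where open ≡-Reasoning

take-applyUpTo : (f : ℕ → A) {m n : ℕ} → m ≤ n → take m (applyUpTo f n) ≡ applyUpTo f m
take-applyUpTo f z≤n       = refl
take-applyUpTo f (s≤s m≤n) = cong (f 0 ∷_) (take-applyUpTo (f ∘ suc) m≤n)

-- The ballot condition: the `m`th right step ends at height `length (concat (take m cs))`, which
-- must be at least `m`.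
Ballot : List (List A) → Set
Ballot cs = ∀ m → m ≤ length cs → m ≤ length (concat (take m cs))

length-take-columns : ∀ {n} (a : Vec ℕ n) → VecAll.All (1 ≤_) a → ∀ {m} → m ≤ n →
  length (concat (take m (columns a))) ≡ length (filter (_≤? m) (toList a))
length-take-columns a positive {m} m≤n = trans
  (cong (length ∘ concat) (take-applyUpTo (column (Vec.lookup a) (allFin _)) m≤n))
  (trans (length-concat-columns (Vec.lookup a) (allFin _) (VecAll.lookup⁺ positive) m)
         (length-filter-lookup (_≤? m) a))

length-columns : ∀ {n} (a : Vec ℕ n) → length (columns a) ≡ n
length-columns a = length-applyUpTo _ _

IsParkingFunction⇔Ballot : ∀ {n} (a : Vec ℕ n) →
  IsParkingFunction a ⇔ (VecAll.All (1 ≤_) a × Ballot (columns a))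
IsParkingFunction⇔Ballot {n} a = mk⇔ to from
  where
  open Equivalence (IsParkingFunction⇔count a) using () renaming (to to count⁺; from to count⁻)
  to : IsParkingFunction a → _
  to pf with count⁺ pf
  ... | positive , enough = positive , λ m m≤ → let m≤n = subst (m ≤_) (length-columns a) m≤ in
    subst (m ≤_) (sym (length-take-columns a positive m≤n)) (enough m m≤n)
  from : _ → IsParkingFunction a
  from (positive , ballot) = count⁻ (positive , λ m m≤n →
    subst (m ≤_) (length-take-columns a positive m≤n) (ballot m (subst (m ≤_) (sym (length-columns a)) m≤n)))

-- At most `n`, because the columns select from `n` labels; at least `n`, by the ballot condition
-- for all columns.
length-concat-parking : ∀ {n} (a : Vec ℕ n) → IsParkingFunction a → length (concat (columns a)) ≡ n
length-concat-parking {n} a pf@(positive , _) with Equivalence.to (IsParkingFunction⇔Ballot a) pf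
... | _ , ballot = ≤-antisym
  (subst (_≤ n) (sym (length-concat-columns (Vec.lookup a) (allFin n) (VecAll.lookup⁺ positive) n))
    (≤-trans (length-filter _ (allFin n)) (≤-reflexive (length-tabulate {n = n} id))))
  (subst (λ m → n ≤ length (concat m)) (take-all n (columns a) (≤-reflexive (length-columns a)))
    (ballot n (≤-reflexive (sym (length-columns a)))))

-- Dyck paths and the ballot condition

foldl-move-ups : ∀ {x y} (c : List A) p →
  foldl move (x , y) (map up c ++ p) ≡ foldl move (x , length c + y) p
foldl-move-ups []      p = refl
foldl-move-ups {x = x} {y} (_ ∷ c) p = trans (foldl-move-ups c p)
  (cong (λ y′ → foldl move (x , y′) p) (+-suc (length c) y))

foldl-move-fill : ∀ {x y} (cs : List (List A)) p →
  foldl move (x , y) (fill cs ++ p) ≡ foldl move (length cs + x , length (concat cs) + y) p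
foldl-move-fill []       p = refl
foldl-move-fill {x = x} {y} (c ∷ cs) p = trans
  (cong (foldl move (x , y)) (++-assoc (map up c) _ p))
  (trans (foldl-move-ups c _)
  (trans (foldl-move-fill cs p)
  (cong₂ (λ x′ y′ → foldl move (x′ , y′) p) (+-suc (length cs) x) eq)))
  where
  eq : length (concat cs) + (length c + y) ≡ length (c ++ concat cs) + y
  eq = trans (sym (+-assoc (length (concat cs)) (length c) y))
    (cong (_+ y) (trans (+-comm (length (concat cs)) (length c)) (sym (length-++ c))))

foldl-move-fill₀ : (cs : List (List A)) → foldl move (0 , 0) (fill cs) ≡ (length cs , length (concat cs))
foldl-move-fill₀ cs = trans (cong (foldl move (0 , 0)) (sym (++-identityʳ (fill cs))))
  (trans (foldl-move-fill cs []) (cong₂ _,_ (+-identityʳ _) (+-identityʳ _)))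

move-mapStep : (f : A → B) (s : Point) (t : Step A) → move s (mapStep f t) ≡ move s t
move-mapStep f s (up _) = refl
move-mapStep f s right  = refl

foldl-move-underlying : ∀ s (p : List (Step A)) → foldl move s (underlying p) ≡ foldl move s p
foldl-move-underlying s []      = refl
foldl-move-underlying s (t ∷ p) rewrite move-mapStep (λ _ → tt) s t = foldl-move-underlying (move s t) p

scanl-move-underlying : ∀ s (p : List (Step A)) → scanl move s (underlying p) ≡ scanl move s p
scanl-move-underlying s []      = refl
scanl-move-underlying s (t ∷ p) rewrite move-mapStep (λ _ → tt) s t =
  cong (s ∷_) (scanl-move-underlying (move s t) p)

All-scanl-prefix : ∀ {P : B → Set} {f : B → A → B} {e} xs {ys} →
  All P (scanl f e (xs ++ ys)) → P (foldl f e xs)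
All-scanl-prefix []       {[]}     (pe ∷ _) = pe
All-scanl-prefix []       {_ ∷ _}  (pe ∷ _) = pe
All-scanl-prefix (x ∷ xs)          (_ ∷ ps) = All-scanl-prefix xs ps

-- Up steps only gain height, so the start and the ends of the right steps decide. The starting
-- point is arbitrary for the sake of the induction on columns.
above-fill : ∀ {x y} (cs : List (List A)) →
  (∀ m → m ≤ length cs → m + x ≤ length (concat (take m cs)) + y) →
  All WeaklyAboveDiagonal (scanl move (x , y) (fill cs))
above-fill []       ballot = ballot 0 z≤n ∷ []
above-fill {A = A} {x} {y} (c ∷ cs) ballot = above-ups c (ballot 0 z≤n)
  (above-fill cs λ m m≤ → subst₂ _≤_ (sym (+-suc m x)) (eq m) (ballot (suc m) (s≤s m≤)))
  where
  eq : ∀ m → length (c ++ concat (take m cs)) + y ≡ length (concat (take m cs)) + (length c + y)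
  eq m = trans (cong (_+ y) (trans (length-++ c) (+-comm (length c) _))) (+-assoc (length (concat (take m cs))) _ y)

  above-ups : ∀ {x y} (d : List A) → x ≤ y →
    All WeaklyAboveDiagonal (scanl move (suc x , length d + y) (fill cs)) →
    All WeaklyAboveDiagonal (scanl move (x , y) (map up d ++ right ∷ fill cs))
  above-ups []      x≤y above = x≤y ∷ above
  above-ups {x} {y} (_ ∷ d) x≤y above = x≤y ∷ above-ups d (m≤n⇒m≤1+n x≤y)
    (subst (λ z → All WeaklyAboveDiagonal (scanl move (suc x , z) (fill cs))) (sym (+-suc (length d) y)) above)

IsDyckPath-fill⁺ : (cs : List (List A)) → length (concat cs) ≡ length cs → Ballot cs →
  IsDyckPath (length cs) (underlying (fill cs))
IsDyckPath-fill⁺ cs total ballot =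
  trans (foldl-move-underlying (0 , 0) (fill cs)) (trans (foldl-move-fill₀ cs) (cong (length cs ,_) total)) ,
  subst (All WeaklyAboveDiagonal) (sym (scanl-move-underlying (0 , 0) (fill cs)))
    (above-fill cs λ m m≤ → subst₂ _≤_ (sym (+-identityʳ m)) (sym (+-identityʳ _)) (ballot m m≤))

-- The remainder `p` allows for up steps after the last column, not yet known to be absent. The
-- first `m` columns form a prefix of the path, whose endpoint is one of the scanned points.
ballot-fill : (cs : List (List A)) {p : List (Step A)} →
  All WeaklyAboveDiagonal (scanl move (0 , 0) (fill cs ++ p)) → Ballot cs
ballot-fill cs {p} above m m≤ = subst₂ _≤_ (trans (length-take m cs) (m≤n⇒m⊓n≡m m≤)) refl
  (subst WeaklyAboveDiagonal (foldl-move-fill₀ (take m cs))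
    (All-scanl-prefix (fill (take m cs)) (subst (λ q → All WeaklyAboveDiagonal (scanl move (0 , 0) q)) eq above)))
  where
  eq : fill cs ++ p ≡ fill (take m cs) ++ fill (drop m cs) ++ p
  eq = trans (cong (λ ds → fill ds ++ p) (sym (take++drop≡id m cs)))
    (trans (cong (_++ p) (fill-++ (take m cs) (drop m cs))) (++-assoc (fill (take m cs)) _ p))

length≡0⇒≡[] : (xs : List A) → length xs ≡ 0 → xs ≡ []
length≡0⇒≡[] [] _ = refl

-- After the last right step the abscissa is `n`, so the height is already at least `n`; since the
-- path ends at height `n`, no up steps `r` can follow.
IsDyckPath-fill⁻ : ∀ {n} (p : List (Step A)) → IsDyckPath n (underlying p) →
  ∃[ cs ] (p ≡ fill cs × length cs ≡ n × length (concat cs) ≡ n × Ballot cs)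
IsDyckPath-fill⁻ {n = n} p (end , above) with unfill p
... | cs , r , refl = cs , trans (cong (λ r → fill cs ++ map up r) r≡[]) (++-identityʳ _) ,
                      lengthˣ , ≤-antisym upper lower , ballot
  where
  ballot : Ballot cs
  ballot = ballot-fill cs (subst (All WeaklyAboveDiagonal) (scanl-move-underlying (0 , 0) _) above)

  position : (length cs , length r + length (concat cs)) ≡ (n , n)
  position = trans (sym (trans
      (cong (foldl move (0 , 0)) (sym (++-identityʳ (fill cs ++ map up r))))
      (trans (cong (foldl move (0 , 0)) (++-assoc (fill cs) (map up r) []))
      (trans (foldl-move-fill cs (map up r ++ []))
      (trans (foldl-move-ups r []) (cong₂ _,_ (+-identityʳ _) (cong (length r +_) (+-identityʳ _))))))))
    (trans (sym (foldl-move-underlying (0 , 0) (fill cs ++ map up r))) end)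

  lengthˣ : length cs ≡ n
  lengthˣ = proj₁ (,-injective position)

  lower : n ≤ length (concat cs)
  lower = subst₂ (λ m ds → m ≤ length (concat ds)) lengthˣ (take-all (length cs) cs ≤-refl)
    (ballot (length cs) ≤-refl)

  upper : length (concat cs) ≤ n
  upper = subst (length (concat cs) ≤_) (proj₂ (,-injective position)) (m≤n+m _ (length r))

  r≡[] : r ≡ []
  r≡[] = length≡0⇒≡[] r (n≤0⇒n≡0 (+-cancelʳ-≤ (length (concat cs)) _ _
    (≤-trans (≤-reflexive (proj₂ (,-injective position))) lower)))

-- Label conditions on columns

Linked-right-∷ : ∀ {n} {p : LabeledPath n} → Linked _<ᵘ_ p → Linked _<ᵘ_ (right ∷ p)
Linked-right-∷ []           = [-]
Linked-right-∷ [-]          = tt ∷ [-]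
Linked-right-∷ (r ∷ linked) = tt ∷ r ∷ linked

-- A `right` imposes no constraint on its neighbours, so the condition along the path splits into
-- one for each column.
Linked-fill⁺ : ∀ {n} {cs : List (List (Fin n))} → All (Linked Fin._<_) cs → Linked _<ᵘ_ (fill cs)
Linked-fill⁺ []       = []
Linked-fill⁺ {n} {c ∷ cs} (l ∷ ls) = go l
  where
  go : ∀ {d : List (Fin n)} → Linked Fin._<_ d → Linked _<ᵘ_ (map up d ++ right ∷ fill cs)
  go []         = Linked-right-∷ (Linked-fill⁺ ls)
  go [-]        = tt ∷ Linked-right-∷ (Linked-fill⁺ ls)
  go (i<j ∷ l)  = i<j ∷ go l

Linked-fill⁻ : ∀ {n} (cs : List (List (Fin n))) → Linked _<ᵘ_ (fill cs) → All (Linked Fin._<_) cs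
Linked-fill⁻ []       linked = []
Linked-fill⁻ {n} (c ∷ cs) linked with go c linked
  where
  go : ∀ (d : List (Fin n)) → Linked _<ᵘ_ (map up d ++ right ∷ fill cs) → Linked Fin._<_ d × Linked _<ᵘ_ (fill cs)
  go []          linked       = [] , Linked.tail linked
  go (i ∷ [])    (_ ∷ linked) = [-] , Linked.tail linked
  go (i ∷ j ∷ d) (i<j ∷ linked) with go (j ∷ d) linked
  ... | l , rest = i<j ∷ l , rest
... | l , rest = l ∷ Linked-fill⁻ cs rest

AllPairs-<-column : ∀ {n} (f : Fin n → ℕ) i → AllPairs Fin._<_ (column f (allFin n) i)
AllPairs-<-column f i = AllPairs.filter⁺ _ (AllPairs.tabulate⁺-< id)

Unique-columns : ∀ {n} (a : Vec ℕ n) → Unique (concat (columns a))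
Unique-columns {n} a = Unique.concat⁺
  (All.applyUpTo⁺₂ _ n λ i → Unique.filter⁺ _ (Unique.allFin⁺ n))
  (AllPairs.applyUpTo⁺₁ _ n λ {i} {j} i<j _ (∈i , ∈j) → <⇒≢ i<j (suc-injective
    (trans (proj₂ (∈-filter⁻ (λ k → suc i ≟ Vec.lookup a k) {xs = allFin n} ∈i))
      (sym (proj₂ (∈-filter⁻ (λ k → suc j ≟ Vec.lookup a k) {xs = allFin n} ∈j))))))

IsLabeledDyckPath-columns : ∀ {n} (a : Vec ℕ n) → IsParkingFunction a → IsLabeledDyckPath n (fill (columns a))
IsLabeledDyckPath-columns {n} a pf = record
  { isDyckPath = subst (λ m → IsDyckPath m (underlying (fill (columns a)))) (length-columns a)
      (IsDyckPath-fill⁺ (columns a) (trans (length-concat-parking a pf) (sym (length-columns a)))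
        (proj₂ (Equivalence.to (IsParkingFunction⇔Ballot a) pf)))
  ; labelsDistinct = subst Unique (sym (labels-fill (columns a))) (Unique-columns a)
  ; columnsIncreasing = Linked-fill⁺ (All.applyUpTo⁺₂ _ n λ i →
      AllPairs⇒Linked (AllPairs-<-column (Vec.lookup a) i))
  }

-- Recovering a parking function from a labeled Dyck path

-- Both heads are the minimum of the same set, hence equal; neither recurs in its tail, so the tails
-- again have the same elements.
strictly-increasing-ext : ∀ {n} {xs ys : List (Fin n)} → AllPairs Fin._<_ xs → AllPairs Fin._<_ ys →
  (∀ {j} → j ∈ xs → j ∈ ys) → (∀ {j} → j ∈ ys → j ∈ xs) → xs ≡ ys
strictly-increasing-ext [] [] ⊆ ⊇ = refl
strictly-increasing-ext [] (_ ∷ _) ⊆ ⊇ with () ← ⊇ (here refl)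
strictly-increasing-ext (_ ∷ _) [] ⊆ ⊇ with () ← ⊆ (here refl)
strictly-increasing-ext {n} {x ∷ xs} {y ∷ ys} (x< ∷ xs<) (y< ∷ ys<) ⊆ ⊇ with x≡y
  where
  x≡y : x ≡ y
  x≡y with ⊆ (here refl) | ⊇ (here refl)
  ... | here eq   | _         = eq
  ... | there _   | here eq   = sym eq
  ... | there x∈ | there y∈ = contradiction (All.lookup x< y∈) (<ᶠ-asym (All.lookup y< x∈))
... | refl = cong (x ∷_) (strictly-increasing-ext xs< ys< (strip ⊆ x<) (strip ⊇ y<))
  where
  strip : ∀ {zs ws : List (Fin n)} → (∀ {j} → j ∈ x ∷ zs → j ∈ x ∷ ws) →
    All (x Fin.<_) zs → ∀ {j} → j ∈ zs → j ∈ ws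
  strip inc x<zs j∈ with inc (there j∈)
  ... | here refl = contradiction (All.lookup x<zs j∈) (<ᶠ-irrefl refl)
  ... | there j∈′ = j∈′

-- Junk value: a label in none of the columns gets the number of columns.
columnOf : ∀ {n} → List (List (Fin n)) → Fin n → ℕ
columnOf []       j = 0
columnOf (c ∷ cs) j with member? _≟ᶠ_ j c
... | yes _ = 0
... | no  _ = suc (columnOf cs j)

Unique-++-disjoint : (xs : List A) {ys : List A} → Unique (xs ++ ys) → Disjoint xs ys
Unique-++-disjoint (x ∷ xs) (x∉ ∷ u) (here refl , x∈ys) = All.lookup x∉ (∈-++⁺ʳ xs x∈ys) refl
Unique-++-disjoint (x ∷ xs) (x∉ ∷ u) (there x∈xs , x∈ys) = Unique-++-disjoint xs u (x∈xs , x∈ys)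

AllPairs-++⁻ʳ : {R : A → A → Set} (xs : List A) {ys : List A} → AllPairs R (xs ++ ys) → AllPairs R ys
AllPairs-++⁻ʳ []       rs       = rs
AllPairs-++⁻ʳ (x ∷ xs) (_ ∷ rs) = AllPairs-++⁻ʳ xs rs

-- `columnOf` finds the first column containing `j`; distinctness of the labels makes it the only
-- one.
columnOf-lookup⁺ : ∀ {n} (cs : List (List (Fin n))) → Unique (concat cs) →
  ∀ i {j} → j ∈ lookup cs i → columnOf cs j ≡ toℕ i
columnOf-lookup⁺ (c ∷ cs) unique Fin.zero    {j} j∈ with member? _≟ᶠ_ j c
... | yes _   = refl
... | no  j∉ = contradiction j∈ j∉
columnOf-lookup⁺ (c ∷ cs) unique (Fin.suc i) {j} j∈ with member? _≟ᶠ_ j c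
... | yes j∈c = contradiction (j∈c , ∈-concat⁺′ j∈ (∈-lookup {xs = cs} i)) (Unique-++-disjoint c unique)
... | no  _   = cong suc (columnOf-lookup⁺ cs (AllPairs-++⁻ʳ c unique) i j∈)

columnOf-lookup⁻ : ∀ {n} (cs : List (List (Fin n))) i {j} → columnOf cs j ≡ toℕ i → j ∈ lookup cs i
columnOf-lookup⁻ (c ∷ cs) i           {j} eq with member? _≟ᶠ_ j c
columnOf-lookup⁻ (c ∷ cs) Fin.zero    {j} eq | yes j∈c = j∈c
columnOf-lookup⁻ (c ∷ cs) (Fin.suc i) {j} eq | no  _   = columnOf-lookup⁻ cs i (suc-injective eq)

applyUpTo-lookup : (xs : List A) (h : ℕ → A) → (∀ i → h (toℕ i) ≡ lookup xs i) → applyUpTo h (length xs) ≡ xs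
applyUpTo-lookup []       h eq = refl
applyUpTo-lookup (x ∷ xs) h eq = cong₂ _∷_ (eq Fin.zero) (applyUpTo-lookup xs (h ∘ suc) (eq ∘ Fin.suc))

-- The inverse construction to `columns`; `suc` passes from columns counted from 0 to entries
-- counted from 1.
columnVec : ∀ {n} → List (List (Fin n)) → Vec ℕ n
columnVec cs = Vec.tabulate (suc ∘ columnOf cs)

-- Distinct labels give equality of columns as sets, increasing columns give equality as lists.
columns-columnVec : ∀ {n} (cs : List (List (Fin n))) → length cs ≡ n →
  Unique (concat cs) → All (AllPairs Fin._<_) cs → columns (columnVec cs) ≡ cs
columns-columnVec {n} cs size unique increasing = trans (cong (applyUpTo _) (sym size))
  (applyUpTo-lookup cs _ λ i →
  strictly-increasing-ext (AllPairs-<-column _ (toℕ i)) (All.lookup increasing (∈-lookup i))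
    (λ {j} j∈ → columnOf-lookup⁻ cs i (suc-injective (sym (trans
      (proj₂ (∈-filter⁻ (λ k → suc (toℕ i) ≟ Vec.lookup (columnVec cs) k) {xs = allFin n} j∈))
      (Vec.lookup∘tabulate _ j)))))
    (λ {j} j∈ → ∈-filter⁺ (λ k → suc (toℕ i) ≟ Vec.lookup (columnVec cs) k) (∈-allFin j)
      (sym (trans (Vec.lookup∘tabulate _ j) (cong suc (columnOf-lookup⁺ cs unique i j∈))))))

IsLabeledDyckPath⇒columns : ∀ {n} {p : LabeledPath n} → IsLabeledDyckPath n p →
  ∃[ a ] (IsParkingFunction a × p ≡ fill (columns a))
IsLabeledDyckPath⇒columns {p = p} dyck with IsDyckPath-fill⁻ p (IsLabeledDyckPath.isDyckPath dyck)
... | cs , refl , size , _ , ballot =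
  columnVec cs ,
  Equivalence.from (IsParkingFunction⇔Ballot (columnVec cs))
    (VecAll.tabulate⁺ (λ j → s≤s z≤n) , subst Ballot (sym eq) ballot) ,
  cong fill (sym eq)
  where
  open IsLabeledDyckPath dyck
  eq : columns (columnVec cs) ≡ cs
  eq = columns-columnVec cs size (subst Unique (labels-fill cs) labelsDistinct)
    (All.map (Linked⇒AllPairs <ᶠ-trans) (Linked-fill⁻ cs columnsIncreasing))

-- Final up-right pairs and nonempty columns

NonEmpty : List A → Set
NonEmpty xs = 0 < length xs

length≤length-concat : {cs : List (List A)} → All NonEmpty cs → length cs ≤ length (concat cs)
length≤length-concat []                     = z≤n
length≤length-concat {cs = c ∷ cs} (0< ∷ ne) = subst (suc (length cs) ≤_) (sym (length-++ c))
  (+-mono-≤ 0< (length≤length-concat ne))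

-- Pigeonhole: nonempty columns with no more labels than columns hold one label each.
underlying-fill-singletons : (cs : List (List A)) → All NonEmpty cs →
  length (concat cs) ≤ length cs → underlying (fill cs) ≡ upRightPairs (length cs)
underlying-fill-singletons []                 []       small = refl
underlying-fill-singletons ((x ∷ []) ∷ cs)    (_ ∷ ne) small =
  cong (λ p → up tt ∷ right ∷ p) (underlying-fill-singletons cs ne (s≤s⁻¹ small))
-- Two labels here would leave fewer labels than columns for `cs`, all of which are nonempty.
underlying-fill-singletons ((x ∷ y ∷ c) ∷ cs) (_ ∷ ne) small = contradiction
  (≤-trans (s≤s (m≤n+m _ (length c)))
    (≤-trans (s≤s (≤-reflexive (sym (length-++ c))))
      (≤-trans (s≤s⁻¹ small) (length≤length-concat ne)))) 1+n≰n

EndsInPairs-fill⁺ : ∀ {n m} (cs : List (List (Fin n))) → length (concat cs) ≡ length cs → Ballot cs →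
  m ≤ length cs → All NonEmpty (drop (length cs ∸ m) cs) → EndsInPairs m (fill cs)
EndsInPairs-fill⁺ {m = m} cs total ballot m≤ ne =
  underlying (fill front) , trans (cong (underlying ∘ fill) (sym (take++drop≡id k cs)))
    (trans (cong underlying (fill-++ front back))
    (trans (map-++ _ (fill front) (fill back))
      (cong (underlying (fill front) ++_)
        (trans (underlying-fill-singletons back ne (subst (length (concat back) ≤_) (sym size) small))
          (cong upRightPairs size)))))
  where
  k = length cs ∸ m
  front = take k cs
  back  = drop k cs
  size : length back ≡ m
  size = trans (length-drop k cs) (m∸[m∸n]≡n m≤)
  total′ : length (concat front) + length (concat back) ≡ k + m
  total′ = trans (sym (length-++ (concat front)))
    (trans (cong length (trans (concat-++ front back) (cong concat (take++drop≡id k cs))))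
      (trans total (sym (m∸n+n≡m m≤))))
  small : length (concat back) ≤ m
  small = +-cancelˡ-≤ k _ _ (≤-trans (+-monoˡ-≤ _ (ballot k (m∸n≤m (length cs) m))) (≤-reflexive total′))

fill-replicate-pairs : ∀ m → fill (replicate m (tt ∷ [])) ≡ upRightPairs m
fill-replicate-pairs zero    = refl
fill-replicate-pairs (suc m) = cong (λ p → up tt ∷ right ∷ p) (fill-replicate-pairs m)

-- Up steps `r` at the end of `q` merge with the first pair into a single column, so the last
-- `suc m` columns are nonempty but the first of them need not be a singleton.
++-pairs-fill : ∀ q m → ∃[ qs ] ∃[ ds ]
  (q ++ upRightPairs (suc m) ≡ fill (qs ++ ds) × length ds ≡ suc m × All NonEmpty ds)
++-pairs-fill q m with unfill q
... | qs , r , refl = qs , (r ++ tt ∷ []) ∷ replicate m (tt ∷ []) , eq ,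
  cong suc (length-replicate m) , nonEmpty r ∷ All.replicate⁺ m (s≤s z≤n)
  where
  nonEmpty : ∀ r → NonEmpty (r ++ tt ∷ [])
  nonEmpty []      = s≤s z≤n
  nonEmpty (_ ∷ _) = s≤s z≤n
  eq : (fill qs ++ map up r) ++ upRightPairs (suc m) ≡ fill (qs ++ (r ++ tt ∷ []) ∷ replicate m (tt ∷ []))
  eq = trans (++-assoc (fill qs) (map up r) _) (trans
    (cong (fill qs ++_) (trans
      (cong (λ p → map up r ++ up tt ∷ right ∷ p) (sym (fill-replicate-pairs m)))
      (trans (sym (++-assoc (map up r) (up tt ∷ []) _))
        (cong (_++ right ∷ fill (replicate m (tt ∷ []))) (sym (map-++ up r (tt ∷ [])))))))
    (sym (fill-++ qs _)))

drop-length-++ : (xs : List A) {ys : List A} → drop (length xs) (xs ++ ys) ≡ ys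
drop-length-++ []       = refl
drop-length-++ (x ∷ xs) = drop-length-++ xs

-- Decomposition into columns is unique, so the columns found by `++-pairs-fill` are those of `cs`
-- with labels erased, which preserves lengths.
EndsInPairs-fill⁻ : ∀ {n} m (cs : List (List (Fin n))) → EndsInPairs m (fill cs) →
  All NonEmpty (drop (length cs ∸ m) cs)
EndsInPairs-fill⁻ zero    cs _ = subst (All NonEmpty) (sym (drop-all (length cs) cs ≤-refl)) []
EndsInPairs-fill⁻ (suc m) cs (q , eq) with ++-pairs-fill q m
... | qs , ds , eq′ , size , ne =
  All.map (λ {c} → subst (0 <_) (length-map _ c)) (All.map⁻ (subst (All NonEmpty)
    (trans (sym (drop-length-++ qs))
      (trans (cong₂ drop (sym k≡) (sym cs≡)) (drop-map (length cs ∸ suc m) cs))) ne))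
  where
  cs≡ : map (map (λ _ → tt)) cs ≡ qs ++ ds
  cs≡ = fill-injective _ _ (trans (sym (map-fill _ cs)) (trans eq eq′))
  k≡ : length cs ∸ suc m ≡ length qs
  k≡ = trans (cong₂ _∸_
      (trans (sym (length-map _ cs)) (trans (cong length cs≡) (length-++ qs))) (sym size))
    (m+n∸n≡m (length qs) (length ds))

∈⇔NonEmpty-column : ∀ {n} (a : Vec ℕ n) i →
  suc i ∈ᵛ a ⇔ NonEmpty (column (Vec.lookup a) (allFin n) i)
∈⇔NonEmpty-column {n} a i = mk⇔ to from
  where
  to : suc i ∈ᵛ a → _
  to i∈ = ∈-length (∈-filter⁺ (λ j → suc i ≟ Vec.lookup a j) (∈-allFin (VecAny.index i∈)) (VecAny.lookup-index i∈))
  from : NonEmpty (column (Vec.lookup a) (allFin n) i) → suc i ∈ᵛ a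
  from ne with column (Vec.lookup a) (allFin n) i in eq
  ... | j ∷ _ with ∈-filter⁻ (λ k → suc i ≟ Vec.lookup a k) {xs = allFin n} (subst (j ∈_) (sym eq) (here refl))
  ... | _ , i≡ = subst (_∈ᵛ a) (sym i≡) (∈ᵛ-lookup j a)

drop-applyUpTo : (f : ℕ → A) → ∀ k n → drop k (applyUpTo f n) ≡ applyUpTo (f ∘ (k +_)) (n ∸ k)
drop-applyUpTo f zero    n       = refl
drop-applyUpTo f (suc k) zero    = refl
drop-applyUpTo f (suc k) (suc n) = drop-applyUpTo (f ∘ suc) k n

EndsInPairs-columns : ∀ {n m} (a : Vec ℕ n) → IsParkingFunction a → m ≤ n →
  EndsInPairs m (fill (columns a)) ⇔ (∀ i → n ∸ m < i → i ≤ n → i ∈ᵛ a)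
EndsInPairs-columns {n} {m} a pf m≤n = mk⇔ to from
  where
  k = n ∸ m
  drop-columns : drop (length (columns a) ∸ m) (columns a)
    ≡ applyUpTo (column (Vec.lookup a) (allFin n) ∘ (k +_)) (n ∸ k)
  drop-columns = trans (cong (λ l → drop (l ∸ m) (columns a)) (length-columns a)) (drop-applyUpTo _ k n)
  to : EndsInPairs m (fill (columns a)) → _
  -- The number `suc i` belongs to column `i` counted from 0, at position `i ∸ k` after the first
  -- `k` columns are dropped.
  to ends (suc i) (s≤s k≤i) i<n = Equivalence.from (∈⇔NonEmpty-column a i)
    (subst (NonEmpty ∘ column (Vec.lookup a) (allFin n)) (m+[n∸m]≡n k≤i)
      (All.applyUpTo⁻ (column (Vec.lookup a) (allFin n) ∘ (k +_)) (n ∸ k)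
        (subst (All NonEmpty) drop-columns (EndsInPairs-fill⁻ m (columns a) ends))
        (∸-monoˡ-< i<n k≤i)))
  from : _ → EndsInPairs m (fill (columns a))
  from present = EndsInPairs-fill⁺ (columns a)
    (trans (length-concat-parking a pf) (sym (length-columns a)))
    (proj₂ (Equivalence.to (IsParkingFunction⇔Ballot a) pf))
    (subst (m ≤_) (sym (length-columns a)) m≤n)
    (subst (All NonEmpty) (sym drop-columns) (All.applyUpTo⁺₁ _ (n ∸ k) λ {i} i< →
      Equivalence.to (∈⇔NonEmpty-column a (k + i)) (present _ (s≤s (m≤m+n k i))
        (subst₂ _≤_ (+-suc k i) (m+[n∸m]≡n (m∸n≤m n m)) (+-monoʳ-≤ k i<)))))

-- Permutations, largest missing numbers and the theorem

-- Each `x` is removed from `ys`; the rest of `xs` differs from it and stays inside. When `xs` is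
-- exhausted, the length bound leaves `ys` empty.
Unique-⊆⇒↭ : {xs ys : List A} → Unique xs → (∀ {x} → x ∈ xs → x ∈ ys) → length ys ≤ length xs → ys ↭ xs
Unique-⊆⇒↭ {ys = []}    []  ⊆ small = ↭-reflexive refl
Unique-⊆⇒↭ {xs = x ∷ xs} (x∉ ∷ unique) ⊆ small with ∈-∃++ (⊆ (here refl))
... | us , vs , refl = ↭-trans (shift x us vs) (prep x (Unique-⊆⇒↭ unique ⊆′
    (s≤s⁻¹ (subst (_≤ suc (length xs)) (↭-length (shift x us vs)) small))))
  where
  ⊆′ : ∀ {y} → y ∈ xs → y ∈ us ++ vs
  ⊆′ y∈ with ∈-resp-↭ (shift x us vs) (⊆ (there y∈))
  ... | here refl = contradiction refl (All.lookup x∉ y∈)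
  ... | there y∈′ = y∈′

IsPermutation⇔∈ : ∀ {n} (a : Vec ℕ n) →
  IsPermutation n a ⇔ (IsParkingFunction a × ∀ i → 0 < i → i ≤ n → i ∈ᵛ a)
IsPermutation⇔∈ {n} a = mk⇔
  (λ { (pf , a↭) → pf , λ { (suc i) _ i<n → ∈-toList⁻ (∈-resp-↭ (↭-sym a↭) (∈-applyUpTo⁺ suc i<n)) } })
  (λ { (pf , present) → pf , Unique-⊆⇒↭
    (Unique.applyUpTo⁺₁ suc n λ i<j _ → <⇒≢ (s≤s i<j))
    (λ x∈ → let i , i<n , eq = ∈-applyUpTo⁻ suc x∈ in
      subst (_∈ toList a) (sym eq) (∈-toList⁺ (present (suc i) (s≤s z≤n) i<n)))
    (≤-reflexive (trans (Vec.length-toList a) (sym (length-applyUpTo suc n)))) })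

-- The ballot condition at `m = 1`. It supplies the one number about which the last `n` of the
-- `suc n` columns say nothing.
1∈parking : ∀ {n} (a : Vec ℕ (suc n)) → IsParkingFunction a → 1 ∈ᵛ a
1∈parking a pf = Equivalence.from (∈⇔NonEmpty-column a 0)
  (subst (1 ≤_) (cong length (++-identityʳ (column (Vec.lookup a) (allFin _) 0)))
    (proj₂ (Equivalence.to (IsParkingFunction⇔Ballot a) pf) 1 (s≤s z≤n)))

LargestMissing⇔EndsInExactlyPairs : ∀ {n k} (a : Vec ℕ n) → 0 < k → k ≤ n → IsParkingFunction a →
  LargestMissing n k a ⇔ EndsInExactlyPairs (n ∸ k) (fill (columns a))
LargestMissing⇔EndsInExactlyPairs {n} {suc k} a _ k<n pf = mk⇔
  (λ { (_ , k∉a , present) →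
    Equivalence.from (pairs (m∸n≤m n (suc k))) (λ i n∸< → present i (subst (_< i) (m∸[m∸n]≡n k<n) n∸<)) ,
    λ ends → k∉a (Equivalence.to (pairs more≤) ends (suc k) (≤-reflexive (cong suc k≡)) k<n) })
  (λ { (ends , ¬ends) →
    let present = λ i k<i → Equivalence.to (pairs (m∸n≤m n (suc k))) ends i
                    (subst (_< i) (sym (m∸[m∸n]≡n k<n)) k<i) in
    pf ,
    (λ k∈a → ¬ends (Equivalence.from (pairs more≤) λ i n∸< i≤n →
      [ (λ k<i → present i k<i i≤n) , (λ eq → subst (_∈ᵛ a) eq k∈a) ]′
        (m≤n⇒m<n∨m≡n (subst (_< i) k≡ n∸<)))) ,
    present })
  where
  pairs : ∀ {m} → m ≤ n → EndsInPairs m (fill (columns a)) ⇔ (∀ i → n ∸ m < i → i ≤ n → i ∈ᵛ a)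
  pairs = EndsInPairs-columns a pf
  more : suc (n ∸ suc k) ≡ n ∸ k
  more = sym (+-∸-assoc 1 k<n)
  more≤ : suc (n ∸ suc k) ≤ n
  more≤ = subst (_≤ n) (sym more) (m∸n≤m n k)
  -- The missing number is `suc k`. One more pair lowers the strict bound from `suc k` to `k`, so
  -- `suc k` is the only number added.
  k≡ : n ∸ suc (n ∸ suc k) ≡ k
  k≡ = trans (cong (n ∸_) more) (m∸[m∸n]≡n (<⇒≤ k<n))

IsPermutation⇔EndsInPairs : ∀ {n} (a : Vec ℕ n) → 1 ≤ n → IsParkingFunction a →
  IsPermutation n a ⇔ EndsInPairs (n ∸ 1) (fill (columns a))
IsPermutation⇔EndsInPairs {suc n} a _ pf = mk⇔
  (λ perm → Equivalence.from pairs λ i n∸< →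
    proj₂ (Equivalence.to (IsPermutation⇔∈ a) perm) i (≤-trans (s≤s z≤n) n∸<))
  (λ ends → Equivalence.from (IsPermutation⇔∈ a) (pf , λ
    { (suc zero)    _ _   → 1∈parking a pf
    ; (suc (suc i)) _ i<n → Equivalence.to pairs ends (suc (suc i))
        (subst (_< suc (suc i)) (sym (m+n∸n≡m 1 n)) (s≤s (s≤s z≤n))) i<n }))
  where
  pairs : EndsInPairs n (fill (columns a)) ⇔ (∀ i → suc n ∸ n < i → i ≤ suc n → i ∈ᵛ a)
  pairs = EndsInPairs-columns a pf (n≤1+n n)

-- Shared by `k = 1` and `k > 1`: a property of parking functions is carried to labeled Dyck paths
-- once it is compared with `Q` on paths `fill (columns a)`.
correspondence : ∀ {n} {P : Vec ℕ n → Set} {Q : LabeledPath n → Set} →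
  (∀ a → P a → IsParkingFunction a) → (∀ a → IsParkingFunction a → P a ⇔ Q (fill (columns a))) →
  ∀ p → (∃[ a ] (P a × CorrespondsTo a p)) ⇔ (IsLabeledDyckPath n p × Q p)
correspondence {n} {P} {Q} P⇒pf P⇔Q p = mk⇔ to from
  where
  to : ∃[ a ] (P a × CorrespondsTo a p) → IsLabeledDyckPath n p × Q p
  to (a , pa , corr) with Equivalence.to (CorrespondsTo⇔fill a p) corr
  ... | refl = IsLabeledDyckPath-columns a (P⇒pf a pa) , Equivalence.to (P⇔Q a (P⇒pf a pa)) pa
  from : IsLabeledDyckPath n p × Q p → ∃[ a ] (P a × CorrespondsTo a p)
  from (dyck , q) with IsLabeledDyckPath⇒columns dyck
  ... | a , pf , refl = a , Equivalence.from (P⇔Q a pf) q , Equivalence.from (CorrespondsTo⇔fill a p) refl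

theorem4p4 : (n : ℕ) →
    ((k : ℕ) → 1 < k → k ≤ n → (p : LabeledPath n) →
    D n k p ⇔ (IsLabeledDyckPath n p × EndsInExactlyPairs (n ∸ k) p))
    × (1 ≤ n → (p : LabeledPath n) →
    D n 1 p ⇔ (IsLabeledDyckPath n p × EndsInPairs (n ∸ 1) p))
theorem4p4 n =
  -- `D n k` unfolds to its second clause only when `k` is visibly different from 1.
  (λ { (suc (suc k)) _ k≤n → correspondence (λ _ → proj₁)
         (λ a → LargestMissing⇔EndsInExactlyPairs a (s≤s z≤n) k≤n)
     ; (suc zero) (s≤s ()) }) ,
  (λ 1≤n → correspondence (λ _ → proj₁) (λ a → IsPermutation⇔EndsInPairs a 1≤n))
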